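{- Let $s_l=(a_j)$, $1\le j\le l$, be an ordered string of non-negative integers, let $k=\max\{a_j:1\le j\le l\}$, and let $r$ be a non-negative integer. Then the ornated graph $O_{(2k+1)+r}(s_l)$ has exactly $r+1$ vertices with the maximum possible degree $\Delta(O_{(2k+1)+r}(s_l))=2\sum_{j=1}^{l}a_j$.
   Context: An ordered string $s_l=(a_j)$, $1\le j\le l$ ($l\ge 1$), is an $l$-tuple of non-negative integers; $j$ is the index of the entry $a_j$. For a positive integer $n$, the ornated graph $O_n(s_l)$ is the (in general non-simple) directed graph on vertices $v_1,\dots,v_n$ whose arcs, counted with multiplicity, are the following: each odd-indexed entry $a_t$ contributes one arc $(v_i,v_j)$ for every pair $i<j$ with $i+a_t\ge j$; each even-indexed entry $a_s$ contributes one arc $(v_i,v_j)$ for every pair $i>j$ with $i-a_s\le j$. The degree of a vertex is $d(v)=d^+(v)+d^-(v)$ (out-degree plus in-degree, with multiplicity), and $\Delta(O_n(s_l))$ is the maximum degree. The maximum possible degree associated with $s_l$ is $\max_{n\ge 1}\Delta(O_n(s_l))$. -}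

module Defs where

open import Data.Nat using (ℕ; suc; _+_; _∸_; _⊔_; _≤_; _<_; _>_; _≥_)
open import Data.Nat.Properties using (_≤?_; _<?_; _>?_; _≥?_; +-0-commutativeMonoid)
open import Data.Nat.Divisibility using (_∣_; _∣?_)
open import Data.Fin using (Fin; toℕ)
import Data.Vec as Vec
open import Data.Vec.Functional using (Vector; foldr)
open import Data.Product using (∃-syntax; _×_)
open import Data.Sum using (_⊎_)
open import Relation.Nullary using (¬_; ¬?; _×-dec_; _⊎-dec_)
open import Relation.Unary using (Pred; Decidable)
open import Relation.Binary.PropositionalEquality using (_≡_)
open import Level using (0ℓ)
open import Algebra.Properties.CommutativeMonoid.Sum +-0-commutativeMonoid public using (sum)

-- The default value 0 does not affect the maximum of a nonempty vector of
-- naturals; it is returned only for the empty vector.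
maximum : ∀ {n} → Vector ℕ n → ℕ
maximum = foldr _⊔_ 0

#_ : ∀ {n} {P : Pred (Fin n) 0ℓ} → Decidable P → ℕ
#_ {n} P? = Vec.count P? (Vec.allFin n)

-- A directed graph on n vertices with multiple arcs allowed:
-- G u v is the number of arcs (u , v).
MultiDigraph : ℕ → Set
MultiDigraph n = Fin n → Fin n → ℕ

module _ {n : ℕ} (G : MultiDigraph n) where

  d⁺ d⁻ d : Fin n → ℕ
  d⁺ v = sum (λ w → G v w)
  d⁻ v = sum (λ u → G u v)
  d  v = d⁺ v + d⁻ v

  Δ : ℕ
  Δ = maximum d

-- Vertices v₁ , … , vₙ and entries a₁ , … , aₗ are numbered from 1.
index : ∀ {n} → Fin n → ℕ
index i = suc (toℕ i)

Even Odd : ℕ → Set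
Even m = 2 ∣ m
Odd  m = ¬ (2 ∣ m)

-- The t-th entry of the string contributes an arc (vᵢ , vⱼ).  Truncated
-- subtraction is harmless: if index i < a t, then both index i - a t and
-- index i ∸ a t are at most index j.
Contributes : ∀ {l n} → Vector ℕ l → Fin n → Fin n → Fin l → Set
Contributes a i j t =
    (Odd  (index t) × index i < index j × index i + a t ≥ index j)
  ⊎ (Even (index t) × index i > index j × index i ∸ a t ≤ index j)

contributes? : ∀ {l n} (a : Vector ℕ l) (i j : Fin n) → Decidable (Contributes a i j)
contributes? a i j t =
    (¬? (2 ∣? index t) ×-dec (index i <? index j) ×-dec (index i + a t ≥? index j))
  ⊎-dec
    ((2 ∣? index t) ×-dec (index i >? index j) ×-dec (index i ∸ a t ≤? index j))

O : ∀ (n : ℕ) {l} → Vector ℕ l → MultiDigraph n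
O n a i j = # (contributes? a i j)

-- D = max { Δ(Oₙ(a)) : n ≥ 1 }
IsMaxPossibleDegree : ∀ {l} → Vector ℕ l → ℕ → Set
IsMaxPossibleDegree a D =
    (∃[ n ] (n ≥ 1 × Δ (O n a) ≡ D))
  × (∀ n → n ≥ 1 → Δ (O n a) ≤ D)

{-# OPTIONS --safe #-}
module Submission where

-- In Oₙ(a) every entry aₜ joins v to the next aₜ vertices on one side and to
-- the previous aₜ vertices on the other, as far as they exist; the parity of
-- t only decides which of the two are the out-neighbours.  Hence
--   d(vᵢ) = Σₜ min(aₜ , n − i) + Σₜ min(aₜ , i − 1) ≤ 2 Σₜ aₜ ,
-- with equality iff k ≤ n − i and k ≤ i − 1, where k = max aₜ.  For
-- n = 2k + 1 + r this selects i = k + 1 , … , k + 1 + r.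

open import Defs
open import Data.Bool using (if_then_else_; true; false)
open import Data.Fin using (Fin; zero; suc; toℕ; fromℕ<)
open import Data.Fin.Properties using (toℕ<n; toℕ-fromℕ<)
open import Data.Nat using (ℕ; zero; suc; _+_; _*_; _∸_; _⊓_; _≤_; _<_; _≥_; z≤n; s≤s; s≤s⁻¹)
open import Data.Nat.Divisibility using (_∣?_)
open import Data.Nat.Properties
open import Data.Nat.Tactic.RingSolver using (solve-∀)
open import Data.Product using (_×_; _,_; proj₁; proj₂)
open import Data.Sum using (inj₁; inj₂)
import Data.Vec as Vec
open import Data.Vec.Functional using (Vector)
open import Function using (_∘_; id; _⇔_; mk⇔; Equivalence)
open import Level using (0ℓ)
open import Relation.Binary.PropositionalEquality using (_≡_; refl; sym; trans; cong; cong₂; subst; subst₂; module ≡-Reasoning)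
open import Relation.Nullary using (Dec; yes; no; does; contradiction)
open import Relation.Unary using (Pred; Decidable)

open import Algebra.Properties.CommutativeMonoid.Sum +-0-commutativeMonoid using (∑-comm; ∑-distrib-+; sum-cong-≗)
open Equivalence using (to; from)

-- A deficit in one summand cannot be made up by the other. Equality in a bound proved summand by
-- summand thus passes to every summand.
+-injective-≤ : ∀ {m n o p} → m ≤ n → o ≤ p → m + o ≡ n + p → m ≡ n × o ≡ p
+-injective-≤ {m} {n} {o} {p} m≤n o≤p eq = m≡n , +-cancelˡ-≡ n o p (trans (cong (_+ o) (sym m≡n)) eq)
  where
  m≡n : m ≡ n
  m≡n = ≤-antisym m≤n (+-cancelʳ-≤ o n m (≤-trans (+-monoʳ-≤ n o≤p) (≤-reflexive (sym eq))))

m∸[m∸n]≡n⊓m : ∀ m n → m ∸ (m ∸ n) ≡ n ⊓ m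
m∸[m∸n]≡n⊓m m       zero    = n∸n≡0 m
m∸[m∸n]≡n⊓m zero    (suc n) = refl
m∸[m∸n]≡n⊓m (suc m) (suc n) = trans (+-∸-assoc 1 (m∸n≤m m n)) (cong suc (m∸[m∸n]≡n⊓m m n))

m∸n≤o⇒m≤o+n : ∀ m n {o} → m ∸ n ≤ o → m ≤ o + n
m∸n≤o⇒m≤o+n m n {o} le = ≤-trans (m≤n+m∸n m n) (subst (n + (m ∸ n) ≤_) (+-comm n o) (+-monoʳ-≤ n le))

m≤o+n⇒m∸n≤o : ∀ m n {o} → m ≤ o + n → m ∸ n ≤ o
m≤o+n⇒m∸n≤o m n {o} le = m≤n+o⇒m∸n≤o m n (subst (m ≤_) (+-comm o n) le)

≤-maximum : ∀ {n} (f : Vector ℕ n) i → f i ≤ maximum f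
≤-maximum f zero    = m≤m⊔n _ _
≤-maximum f (suc i) = ≤-trans (≤-maximum (f ∘ suc) i) (m≤n⊔m (f zero) _)

maximum-lub : ∀ {n m} (f : Vector ℕ n) → (∀ i → f i ≤ m) → maximum f ≤ m
maximum-lub {zero}  f f≤m = z≤n
maximum-lub {suc n} f f≤m = ⊔-lub (f≤m zero) (maximum-lub (f ∘ suc) (f≤m ∘ suc))

-- The number of arcs, in either direction, between a vertex and the `m` vertices on one side of it.
∑⊓ : ∀ {l} → Vector ℕ l → ℕ → ℕ
∑⊓ a m = sum (λ t → a t ⊓ m)

∑⊓≤sum : ∀ {l} (a : Vector ℕ l) m → ∑⊓ a m ≤ sum a
∑⊓≤sum {zero}  a m = z≤n
∑⊓≤sum {suc l} a m = +-mono-≤ (m⊓n≤m (a zero) m) (∑⊓≤sum (a ∘ suc) m)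

-- The sums are compared termwise, so they agree only if no entry is cut off by `m`.
∑⊓≡sum⇔maximum≤ : ∀ {l} (a : Vector ℕ l) m → (∑⊓ a m ≡ sum a) ⇔ (maximum a ≤ m)
∑⊓≡sum⇔maximum≤ a m = mk⇔ (maximum-lub a ∘ bounded a)
  λ max≤m → sum-cong-≗ λ t → m≤n⇒m⊓n≡m (≤-trans (≤-maximum a t) max≤m)
  where
  bounded : ∀ {l} (a : Vector ℕ l) → ∑⊓ a m ≡ sum a → ∀ t → a t ≤ m
  bounded {suc l} a eq t with +-injective-≤ (m⊓n≤m (a zero) m) (∑⊓≤sum (a ∘ suc) m) eq
  bounded {suc l} a eq zero    | eq₀ , _  = m⊓n≡m⇒m≤n eq₀
  bounded {suc l} a eq (suc t) | _  , eq₁ = bounded (a ∘ suc) eq₁ t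

𝟙 : ∀ {P : Set} → Dec P → ℕ
𝟙 P? = if does P? then 1 else 0

-- As a sum of indicators, a count over entries can be exchanged with a sum over vertices.
#≡sum-𝟙 : ∀ {n} {P : Pred (Fin n) 0ℓ} (P? : Decidable P) → # P? ≡ sum (𝟙 ∘ P?)
#≡sum-𝟙 {P = P} P? = count-tabulate id
  where
  count-tabulate : ∀ {m} (f : Fin m → Fin _) → Vec.count P? (Vec.tabulate f) ≡ sum (𝟙 ∘ P? ∘ f)
  count-tabulate {zero}  f = refl
  count-tabulate {suc m} f with does (P? (f zero))
  ... | true  = cong suc (count-tabulate (f ∘ suc))
  ... | false = count-tabulate (f ∘ suc)

-- Induction on `n`: dropping the first position moves both ends down by one, stopping at 0. The
-- minimum cuts the interval at `n`, and truncated subtraction gives 0 when it is empty.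
sum-𝟙-interval : ∀ {n} {P : Pred (Fin n) 0ℓ} (P? : Decidable P) p q →
  (∀ w → P w ⇔ (p ≤ toℕ w × toℕ w < q)) → sum (𝟙 ∘ P?) ≡ (q ⊓ n) ∸ p
sum-𝟙-interval {zero} P? p q P⇔ = sym (trans (cong (_∸ p) (⊓-zeroʳ q)) (0∸n≡0 p))
sum-𝟙-interval {suc n} P? p q P⇔ with P? zero
sum-𝟙-interval {suc n} P? zero (suc q) P⇔ | yes _ = cong suc (sum-𝟙-interval (P? ∘ suc) 0 q λ w →
  mk⇔ (λ x → z≤n , s≤s⁻¹ (proj₂ (to (P⇔ (suc w)) x))) (λ (_ , w<q) → from (P⇔ (suc w)) (z≤n , s≤s w<q)))
sum-𝟙-interval {suc n} P? zero zero P⇔ | yes x = contradiction (proj₂ (to (P⇔ zero) x)) λ()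
sum-𝟙-interval {suc n} P? (suc p) q P⇔ | yes x = contradiction (proj₁ (to (P⇔ zero) x)) λ()
sum-𝟙-interval {suc n} P? zero (suc q) P⇔ | no ¬x = contradiction (from (P⇔ zero) (z≤n , s≤s z≤n)) ¬x
-- For `q` zero the interval is empty whatever `p` is, so the recursion may use the bounds 0 and 0.
sum-𝟙-interval {suc n} P? p zero P⇔ | no _ = trans
  (sum-𝟙-interval (P? ∘ suc) 0 0 λ w →
    mk⇔ (λ x → contradiction (proj₂ (to (P⇔ (suc w)) x)) λ()) (λ ()))
  (sym (0∸n≡0 p))
sum-𝟙-interval {suc n} P? (suc p) (suc q) P⇔ | no _ = sum-𝟙-interval (P? ∘ suc) p q λ w →
  mk⇔ (λ x → let (p≤w , w<q) = to (P⇔ (suc w)) x in s≤s⁻¹ p≤w , s≤s⁻¹ w<q)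
      (λ (p≤w , w<q) → from (P⇔ (suc w)) (s≤s p≤w , s≤s w<q))

module _ {n : ℕ} where

  -- Adjacency through an entry of value `s` with the direction forgotten: `i` is always the earlier
  -- vertex. This serves both parities.
  Reaches : ℕ → Fin n → Fin n → Set
  Reaches s i j = index i < index j × index j ≤ index i + s

  -- Counted from 0, the positions reached form the interval from `index v` up to, but excluding,
  -- `index v + s`, cut at `n`.
  sum-𝟙-ahead : ∀ {P : Pred (Fin n) 0ℓ} (P? : Decidable P) s v →
    (∀ w → P w ⇔ Reaches s v w) → sum (𝟙 ∘ P?) ≡ s ⊓ (n ∸ index v)
  sum-𝟙-ahead P? s v P⇔ = begin
    sum (𝟙 ∘ P?)                            ≡⟨ sum-𝟙-interval P? (index v) (index v + s) interval ⟩
    (index v + s) ⊓ n ∸ index v             ≡⟨ ∸-distribʳ-⊓ (index v) (index v + s) n ⟩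
    (index v + s ∸ index v) ⊓ (n ∸ index v) ≡⟨ cong (_⊓ (n ∸ index v)) (m+n∸m≡n (index v) s) ⟩
    s ⊓ (n ∸ index v)                       ∎
    where
    open ≡-Reasoning
    interval : ∀ w → _ ⇔ (index v ≤ toℕ w × toℕ w < index v + s)
    interval w = mk⇔ (λ x → let (v<w , w≤v+s) = to (P⇔ w) x in s≤s⁻¹ v<w , w≤v+s)
                     (λ (v≤w , w<v+s) → from (P⇔ w) (s≤s v≤w , w<v+s))

  -- The positions run from `toℕ v ∸ s` to just before `toℕ v`; here truncated subtraction does the
  -- cutting at the first vertex.
  sum-𝟙-behind : ∀ {P : Pred (Fin n) 0ℓ} (P? : Decidable P) s v →
    (∀ u → P u ⇔ Reaches s u v) → sum (𝟙 ∘ P?) ≡ s ⊓ toℕ v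
  sum-𝟙-behind P? s v P⇔ = begin
    sum (𝟙 ∘ P?)              ≡⟨ sum-𝟙-interval P? (toℕ v ∸ s) (toℕ v) interval ⟩
    toℕ v ⊓ n ∸ (toℕ v ∸ s)   ≡⟨ cong (_∸ (toℕ v ∸ s)) (m≤n⇒m⊓n≡m (<⇒≤ (toℕ<n v))) ⟩
    toℕ v ∸ (toℕ v ∸ s)       ≡⟨ m∸[m∸n]≡n⊓m (toℕ v) s ⟩
    s ⊓ toℕ v                 ∎
    where
    open ≡-Reasoning
    interval : ∀ u → _ ⇔ (toℕ v ∸ s ≤ toℕ u × toℕ u < toℕ v)
    interval u = mk⇔
      (λ x → let (u<v , v≤u+s) = to (P⇔ u) x in
        m≤o+n⇒m∸n≤o (toℕ v) s (s≤s⁻¹ v≤u+s) , s≤s⁻¹ u<v)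
      (λ (v∸s≤u , u<v) →
        from (P⇔ u) (s≤s u<v , s≤s (m∸n≤o⇒m≤o+n (toℕ v) s v∸s≤u)))

module _ {l : ℕ} (a : Vector ℕ l) {n : ℕ} where

  odd-contributes : ∀ {t} → Odd (index t) → (i j : Fin n) → Contributes a i j t ⇔ Reaches (a t) i j
  odd-contributes odd i j = mk⇔
    (λ { (inj₁ (_ , reaches)) → reaches ; (inj₂ (even , _)) → contradiction even odd })
    (λ reaches → inj₁ (odd , reaches))

  -- Even entries send arcs backwards, so the head `j` is the earlier vertex and the arguments of
  -- `Reaches` change places.
  even-contributes : ∀ {t} → Even (index t) → (i j : Fin n) → Contributes a i j t ⇔ Reaches (a t) j i
  even-contributes {t} even i j = mk⇔
    (λ { (inj₁ (odd , _)) → contradiction even odd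
       ; (inj₂ (_ , j<i , i∸a≤j)) → j<i , m∸n≤o⇒m≤o+n (index i) (a t) i∸a≤j })
    (λ (j<i , i≤j+a) → inj₂ (even , j<i , m≤o+n⇒m∸n≤o (index i) (a t) i≤j+a))

  entry-degree : ∀ (v : Fin n) t →
    sum (λ w → 𝟙 (contributes? a v w t)) + sum (λ u → 𝟙 (contributes? a u v t))
      ≡ a t ⊓ (n ∸ index v) + a t ⊓ toℕ v
  entry-degree v t = by-parity (2 ∣? index t)
    where
    by-parity : Dec (Even (index t)) → _
    by-parity (no odd) = cong₂ _+_
      (sum-𝟙-ahead  (λ w → contributes? a v w t) (a t) v λ w → odd-contributes odd v w)
      (sum-𝟙-behind (λ u → contributes? a u v t) (a t) v λ u → odd-contributes odd u v)
    by-parity (yes even) = trans (cong₂ _+_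
      (sum-𝟙-behind (λ w → contributes? a v w t) (a t) v λ w → even-contributes even v w)
      (sum-𝟙-ahead  (λ u → contributes? a u v t) (a t) v λ u → even-contributes even u v))
      (+-comm (a t ⊓ toℕ v) _)

  -- The sums over vertices and entries are exchanged, out- and in-arcs are merged entry by entry,
  -- and the result is split again by side instead of by direction.
  degree : ∀ (v : Fin n) → d (O n a) v ≡ ∑⊓ a (n ∸ index v) + ∑⊓ a (toℕ v)
  degree v = begin
    d (O n a) v
      ≡⟨ cong₂ _+_ (by-entries (λ w → contributes? a v w)) (by-entries (λ u → contributes? a u v)) ⟩
    sum (λ t → sum (λ w → 𝟙 (contributes? a v w t))) + sum (λ t → sum (λ u → 𝟙 (contributes? a u v t)))
      ≡⟨ ∑-distrib-+ (λ t → sum (λ w → 𝟙 (contributes? a v w t))) (λ t → sum (λ u → 𝟙 (contributes? a u v t))) ⟨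
    sum (λ t → sum (λ w → 𝟙 (contributes? a v w t)) + sum (λ u → 𝟙 (contributes? a u v t)))
      ≡⟨ sum-cong-≗ (entry-degree v) ⟩
    sum (λ t → a t ⊓ (n ∸ index v) + a t ⊓ toℕ v)
      ≡⟨ ∑-distrib-+ (λ t → a t ⊓ (n ∸ index v)) (λ t → a t ⊓ toℕ v) ⟩
    ∑⊓ a (n ∸ index v) + ∑⊓ a (toℕ v) ∎
    where
    open ≡-Reasoning
    by-entries : {C : Fin n → Pred (Fin l) 0ℓ} (C? : ∀ w → Decidable (C w)) →
      sum (λ w → # (C? w)) ≡ sum (λ t → sum (λ w → 𝟙 (C? w t)))
    by-entries C? = trans (sum-cong-≗ (λ w → #≡sum-𝟙 (C? w)))
                          (∑-comm (λ w t → 𝟙 (C? w t)))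

  2*sum : 2 * sum a ≡ sum a + sum a
  2*sum = cong (sum a +_) (+-identityʳ (sum a))

  degree≤ : ∀ (v : Fin n) → d (O n a) v ≤ 2 * sum a
  degree≤ v = subst₂ _≤_ (sym (degree v)) (sym 2*sum)
    (+-mono-≤ (∑⊓≤sum a (n ∸ index v)) (∑⊓≤sum a (toℕ v)))

  -- Each side contributes at most `sum a`, so the total reaches `2 * sum a` only if neither side
  -- cuts off an entry.
  degree≡⇔ : ∀ (v : Fin n) → (d (O n a) v ≡ 2 * sum a) ⇔ (maximum a ≤ n ∸ index v × maximum a ≤ toℕ v)
  degree≡⇔ v = mk⇔
    (λ eq → let (eq₁ , eq₂) = +-injective-≤ (∑⊓≤sum a (n ∸ index v)) (∑⊓≤sum a (toℕ v))
                                (trans (sym (degree v)) (trans eq 2*sum))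
            in to (∑⊓≡sum⇔maximum≤ a _) eq₁ , to (∑⊓≡sum⇔maximum≤ a _) eq₂)
    (λ (le₁ , le₂) → trans (degree v) (trans
      (cong₂ _+_ (from (∑⊓≡sum⇔maximum≤ a _) le₁) (from (∑⊓≡sum⇔maximum≤ a _) le₂)) (sym 2*sum)))

Δ≤ : ∀ {l} (a : Vector ℕ l) n → Δ (O n a) ≤ 2 * sum a
Δ≤ a n = maximum-lub (d (O n a)) (degree≤ a)

module _ {l : ℕ} (a : Vector ℕ l) (r : ℕ) where

  private
    k = maximum a
    n = (2 * k + 1) + r
    G = O n a

  -- In this form `k` cancels from `k + index v ≤ n`, which leaves exactly `toℕ v < suc (k + r)`.
  order : n ≡ k + suc (k + r)
  order = lemma k r
    where
    lemma : ∀ k r → (2 * k + 1) + r ≡ k + suc (k + r)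
    lemma = solve-∀

  full-degree⇔ : ∀ v → (d G v ≡ 2 * sum a) ⇔ (k ≤ toℕ v × toℕ v < suc (k + r))
  full-degree⇔ v = mk⇔
    (λ eq → let (k≤n∸v , k≤v) = to (degree≡⇔ a v) eq in
      k≤v , +-cancelˡ-≤ k _ _ (subst (k + index v ≤_) order (m≤o∸n⇒m+n≤o k (toℕ<n v) k≤n∸v)))
    (λ (k≤v , v<) → from (degree≡⇔ a v)
      (m+n≤o⇒m≤o∸n k (subst (k + index v ≤_) (sym order) (+-monoʳ-≤ k v<)) , k≤v))

  Δ≡ : Δ G ≡ 2 * sum a
  Δ≡ = ≤-antisym (Δ≤ a n) (subst (_≤ Δ G) (from (full-degree⇔ c) c-central) (≤-maximum (d G) c))
    where
    k<n : k < n
    k<n = subst (k <_) (sym order) (m<m+n k (s≤s z≤n))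
    -- Position `k` is the first with `k` vertices before it; `k + r` vertices follow it.
    c : Fin n
    c = fromℕ< k<n
    c-central : k ≤ toℕ c × toℕ c < suc (k + r)
    c-central = subst (λ m → k ≤ m × m < suc (k + r)) (sym (toℕ-fromℕ< k<n)) (≤-refl , s≤s (m≤m+n k r))

  #-max-degree : # (λ v → d G v ≟ Δ G) ≡ r + 1
  #-max-degree = begin
    # (λ v → d G v ≟ Δ G)               ≡⟨ #≡sum-𝟙 (λ v → d G v ≟ Δ G) ⟩
    sum (λ v → 𝟙 (d G v ≟ Δ G))         ≡⟨ sum-𝟙-interval (λ v → d G v ≟ Δ G) k (suc (k + r)) max-degree⇔ ⟩
    suc (k + r) ⊓ n ∸ k                 ≡⟨ cong (_∸ k) (m≤n⇒m⊓n≡m (subst (suc (k + r) ≤_) (sym order) (m≤n+m _ k))) ⟩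
    suc (k + r) ∸ k                     ≡⟨ cong (_∸ k) (trans (sym (+-suc k r)) (cong (k +_) (+-comm 1 r))) ⟩
    k + (r + 1) ∸ k                     ≡⟨ m+n∸m≡n k (r + 1) ⟩
    r + 1                               ∎
    where
    open ≡-Reasoning
    max-degree⇔ : ∀ v → (d G v ≡ Δ G) ⇔ (k ≤ toℕ v × toℕ v < suc (k + r))
    max-degree⇔ v = mk⇔ (λ eq → to (full-degree⇔ v) (trans eq Δ≡))
                        (λ bounds → trans (from (full-degree⇔ v) bounds) (sym Δ≡))

proposition2p10 : ∀ (l : ℕ) → l ≥ 1 → (a : Vector ℕ l) (r : ℕ) →
    let k = maximum a
        G = O ((2 * k + 1) + r) a
    in  Δ G ≡ 2 * sum a
      × IsMaxPossibleDegree a (Δ G)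
      × # (λ v → d G v ≟ Δ G) ≡ r + 1
proposition2p10 l _ a r =
    Δ≡ a r
  -- The maximum over all orders is attained at the given order itself; the bound `Δ≤` holds for
  -- every order.
  , ( (_ , subst (_≥ 1) (sym (order a r)) (≤-trans (s≤s z≤n) (m≤n+m _ (maximum a))) , refl)
    , λ n _ → subst (Δ (O n a) ≤_) (sym (Δ≡ a r)) (Δ≤ a n))
  , #-max-degree a r
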